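{- Let $n,k$ be positive integers and let $e_1\ge e_2\ge\dots\ge e_k$ be integers with $\sum_{i=1}^k e_i=\binom{n}{2}$. If $K_n$ has a Gallai $k$-coloring with exactly $e_i$ edges of color $i$ for each $1\le i\le k$, then $$\sum_{i=1}^{\ell} e_i\ge (n-1)+(n-2)+\dots+(n-\ell)$$ for every $1\le \ell\le k$.
   Context: A Gallai $k$-coloring of the complete graph $K_n$ is an assignment of one of the colors $1,\dots,k$ to each edge of $K_n$ (adjacent edges may have the same color) such that no triangle has its three edges colored with three pairwise different colors. -}

module Defs where

open import Data.Nat.Base using (ℕ)
open import Data.Fin.Base using (Fin)
open import Data.Fin.Properties using (_≟_; _<?_)
open import Data.Integer.Properties using (+-0-commutativeMonoid)
open import Data.List.Base using (List; allFin; cartesianProduct; filter; length)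
open import Data.Product.Base using (_×_; proj₁; proj₂)
open import Relation.Binary.PropositionalEquality.Core using (_≡_; _≢_)
open import Relation.Nullary.Negation.Core using (¬_)

open import Algebra.Properties.CommutativeMonoid.Sum +-0-commutativeMonoid public using (sum)

-- The values colour u u carry no meaning: K_n has no loops, and nothing below
-- ever refers to them.
record EdgeColouring (n k : ℕ) : Set where
  field
    colour : Fin n → Fin n → Fin k
    colour-sym : ∀ u v → colour u v ≡ colour v u

open EdgeColouring public

IsGallai : ∀ {n k} → EdgeColouring n k → Set
IsGallai c = ∀ u v w → u ≢ v → v ≢ w → u ≢ w →
  ¬ (colour c u v ≢ colour c v w × colour c v w ≢ colour c u w × colour c u v ≢ colour c u w)

-- Each edge {u , v} of K_n is listed once, as the pair (u , v) with u < v.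
edges : ∀ n → List (Fin n × Fin n)
edges n = filter (λ p → proj₁ p <? proj₂ p) (cartesianProduct (allFin n) (allFin n))

edgesOfColour : ∀ {n k} → EdgeColouring n k → Fin k → List (Fin n × Fin n)
edgesOfColour {n} c i = filter (λ p → colour c (proj₁ p) (proj₂ p) ≟ i) (edges n)

edgeCount : ∀ {n k} → EdgeColouring n k → Fin k → ℕ
edgeCount c i = length (edgesOfColour c i)

{-# OPTIONS --safe #-}
module Submission where

-- It suffices to find, for every ℓ < n, some ℓ colours missing at most (n − ℓ) C 2 edges,
-- since the ℓ most frequent colours do at least as well. These are found by induction on
-- n from Gallai's decomposition: the vertices split either into two parts joined by a single
-- colour, or into three parts joined by at most two colours. The joining colours come first,
-- followed by the colours chosen inside the parts; the count closes because x ↦ (x + 1) C 2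
-- is superadditive. Only ℓ = 1 in the three-part case needs another argument, namely that
-- some colour spans a connected graph.
--
-- The decomposition is built by adding one vertex at a time, passing to the components of
-- the graph formed by the edges whose colour is not one of the two joining colours.

open import Defs
open import Data.Nat.Base as ℕ using (ℕ; zero; suc; z≤n; s≤s)
open import Data.Nat.Combinatorics using (_C_)
open import Data.Fin.Base as Fin using (Fin; toℕ; inject≤)
open import Data.Integer.Base using (ℤ; +_; _-_; _≥_)
open import Data.Product.Base using (_×_; ∃-syntax)
open import Relation.Binary.PropositionalEquality.Core using (_≡_)

open import Data.Bool.Base as Bool using (if_then_else_)
import Data.Integer.Base as ℤ
import Data.Integer.Properties as ℤₚ
open import Algebra.Properties.CommutativeMonoid.Sum ℤₚ.+-0-commutativeMonoid using (sum-cong-≗)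
import Data.Nat.Properties as ℕₚ
open import Data.Fin.Properties using (_≟_; _<?_)
open import Data.Fin.Subset using (Subset; inside; outside; ∣_∣; ⁅_⁆; _∪_; _⊆_)
  renaming (_∈_ to _∈ˢ_; _∉_ to _∉ˢ_; ⊥ to ∅)
open import Data.Fin.Subset.Properties
  using (_∈?_; x∈⁅x⁆; ∣⁅x⁆∣≡1; x∈p∪q⁺; x∈p∪q⁻; p⊆p∪q; q⊆p∪q; ∣⊥∣≡0; ∪-identityˡ)
open import Data.List.Base as List
  using (List; []; _∷_; [_]; _++_; length; map; concat; filter; allFin; cartesianProduct)
open import Data.List.Properties
  using (concat-++; ++-identityʳ; ++-assoc; length-++; length-map; length-tabulate; map-++;
    filter-++; filter-all; filter-none; filter-accept)
import Data.Nat.ListAction as ListAction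
open import Data.Nat.ListAction.Properties using (sum-++; sum-↭)
open import Data.Nat.Solver using (module +-*-Solver)
open import Data.List.Membership.Propositional using (_∈_; find; lose)
open import Data.List.Membership.Propositional.Properties
  using (∈-concat⁻′; ∈-concat⁺′; ∈-++⁻; ∈-++⁺ˡ; ∈-++⁺ʳ; ∈-∃++)
open import Data.List.Relation.Binary.Permutation.Propositional
open import Data.List.Relation.Binary.Permutation.Propositional.Properties
  using (shift; shifts; ++⁺; ++⁺ˡ; ++-comm; ↭-length; All-resp-↭; ∈-resp-↭; map⁺)
import Data.List.Relation.Binary.Permutation.Setoid.Properties as PermSetoid
open import Data.List.Relation.Unary.All as All using (All; []; _∷_)
import Data.List.Relation.Unary.All.Properties as Allₚ
open import Data.List.Relation.Unary.AllPairs using (AllPairs; []; _∷_)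
import Data.List.Relation.Unary.AllPairs.Properties as AllPairsₚ
open import Data.List.Relation.Unary.Any as Any using (Any; here; there)
open import Data.Product.Base using (∃; ∃₂; _,_; proj₁; proj₂)
open import Data.Vec.Base using ([]; _∷_; here; there)
open import Data.Sum.Base using (inj₁; inj₂; [_,_]′)
open import Function.Base using (_∘_)
open import Level using (Level)
open import Relation.Binary.PropositionalEquality as ≡ using (_≢_; refl; cong; cong₂; subst; subst₂)
open import Relation.Nullary using (yes; no; ¬_; does; ¬?; contradiction)
open import Relation.Nullary.Decidable using (decidable-stable)
open import Relation.Unary using (Decidable)

private variable
  a p : Level
  A : Set a

-- Lists up to permutation, unions of subsets, triangular numbers.

concat⁺ : {xss yss : List (List A)} → xss ↭ yss → concat xss ↭ concat yss
concat⁺ refl            = refl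
concat⁺ (prep xs p)     = ++⁺ˡ xs (concat⁺ p)
concat⁺ (swap xs ys p)  = ↭-trans (shifts xs ys) (++⁺ˡ ys (++⁺ˡ xs (concat⁺ p)))
concat⁺ (trans p q)     = ↭-trans (concat⁺ p) (concat⁺ q)

separate : {P : A → Set p} → Decidable P → ∀ xs →
  ∃₂ λ ys zs → xs ↭ ys ++ zs × All P ys × All (¬_ ∘ P) zs
separate P? [] = [] , [] , refl , [] , []
separate P? (x ∷ xs) with separate P? xs | P? x
... | ys , zs , xs↭ , pys , pzs | yes px = x ∷ ys , zs , prep x xs↭ , px ∷ pys , pzs
... | ys , zs , xs↭ , pys , pzs | no ¬px =
  ys , x ∷ zs , ↭-trans (prep x xs↭) (↭-sym (shift x ys zs)) , pys , ¬px ∷ pzs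

AllPairs-resp-↭ : {R : A → A → Set p} → (∀ {x y} → R x y → R y x) →
  {xs ys : List A} → xs ↭ ys → AllPairs R xs → AllPairs R ys
AllPairs-resp-↭ {R = R} sym xs↭ys =
  PermSetoid.AllPairs-resp-↭ (≡.setoid _) sym
    ((λ { refl r → r }) , (λ { refl r → r })) (↭⇒↭ₛ xs↭ys)

AllPairs-++⁻ : {R : A → A → Set p} → ∀ xs {ys} → AllPairs R (xs ++ ys) →
  AllPairs R xs × AllPairs R ys × All (λ x → All (R x) ys) xs
AllPairs-++⁻ [] rs = [] , rs , []
AllPairs-++⁻ (x ∷ xs) (r ∷ rs) with AllPairs-++⁻ xs rs
... | rxs , rys , cross = Allₚ.++⁻ˡ xs r ∷ rxs , rys , Allₚ.++⁻ʳ xs r ∷ cross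

∣p∪q∣≤∣p∣+∣q∣ : ∀ {n} (p q : Subset n) → ∣ p ∪ q ∣ ℕ.≤ ∣ p ∣ ℕ.+ ∣ q ∣
∣p∪q∣≤∣p∣+∣q∣ [] [] = z≤n
∣p∪q∣≤∣p∣+∣q∣ (outside ∷ p) (outside ∷ q) = ∣p∪q∣≤∣p∣+∣q∣ p q
∣p∪q∣≤∣p∣+∣q∣ (inside ∷ p) (outside ∷ q) = s≤s (∣p∪q∣≤∣p∣+∣q∣ p q)
∣p∪q∣≤∣p∣+∣q∣ (outside ∷ p) (inside ∷ q) = ℕₚ.≤-trans (s≤s (∣p∪q∣≤∣p∣+∣q∣ p q))
  (ℕₚ.≤-reflexive (≡.sym (ℕₚ.+-suc ∣ p ∣ ∣ q ∣)))
∣p∪q∣≤∣p∣+∣q∣ (inside ∷ p) (inside ∷ q) = s≤s (ℕₚ.≤-trans (∣p∪q∣≤∣p∣+∣q∣ p q)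
  (ℕₚ.+-monoʳ-≤ ∣ p ∣ (ℕₚ.n≤1+n ∣ q ∣)))

-- This is (m + 1) C 2, the number of edges on m + 1 vertices. The shift suits nonempty lists
-- `v ∷ X`, with m the length of `X`.
triangle : ℕ → ℕ
triangle zero    = 0
triangle (suc m) = suc m ℕ.+ triangle m

triangle-superadditive : ∀ m n → triangle m ℕ.+ triangle n ℕ.≤ triangle (m ℕ.+ n)
triangle-superadditive zero n = ℕₚ.≤-refl
triangle-superadditive (suc m) n = begin
  suc m ℕ.+ triangle m ℕ.+ triangle n     ≡⟨ ℕₚ.+-assoc (suc m) (triangle m) (triangle n) ⟩
  suc m ℕ.+ (triangle m ℕ.+ triangle n)   ≤⟨ ℕₚ.+-mono-≤ (s≤s (ℕₚ.m≤m+n m n)) (triangle-superadditive m n) ⟩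
  suc (m ℕ.+ n) ℕ.+ triangle (m ℕ.+ n)    ∎
  where open ℕₚ.≤-Reasoning

-- Divides a budget of ℓ colours between two parts that can take a and b of them. The choice is
-- greedy: the first part receives min(ℓ, a).
interpolate : ∀ a b {ℓ j} → ℓ ℕ.+ j ≡ a ℕ.+ b →
  ∃[ ℓ₁ ] ∃[ j₁ ] ∃[ ℓ₂ ] ∃[ j₂ ]
    (ℓ₁ ℕ.+ j₁ ≡ a × ℓ₂ ℕ.+ j₂ ≡ b × ℓ₁ ℕ.+ ℓ₂ ≡ ℓ × j₁ ℕ.+ j₂ ≡ j)
interpolate zero b {ℓ} {j} eq = 0 , 0 , ℓ , j , refl , eq , refl , refl
interpolate (suc a) b {zero} eq = 0 , suc a , 0 , b , refl , refl , refl , ≡.sym eq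
interpolate (suc a) b {suc ℓ} eq with interpolate a b {ℓ} (ℕₚ.suc-injective eq)
... | ℓ₁ , j₁ , ℓ₂ , j₂ , eq₁ , eq₂ , eq₃ , eq₄ =
  suc ℓ₁ , j₁ , ℓ₂ , j₂ , cong suc eq₁ , eq₂ , cong suc eq₃ , eq₄

-- Counting edges and comparing with the most frequent colours

pairs : List A → List (A × A)
pairs []       = []
pairs (x ∷ xs) = map (x ,_) xs ++ pairs xs

length-pairs : ∀ (x : A) xs → length (pairs (x ∷ xs)) ≡ triangle (length xs)
length-pairs x [] = refl
length-pairs x xs@(y ∷ ys) = ≡.trans (length-++ (map (x ,_) xs))
  (cong₂ ℕ._+_ (length-map (x ,_) xs) (length-pairs y ys))

-- The rows shrink during the induction while the columns stay complete, so `zs` records the rows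
-- already passed. In the row of x, the columns in `zs` and x itself are filtered out, and exactly
-- those in `xs` survive.
filter-increasing : ∀ {n} (zs xs : List (Fin n)) → All (λ z → All (z Fin.<_) xs) zs → AllPairs Fin._<_ xs →
  filter (λ p → proj₁ p <? proj₂ p) (cartesianProduct xs (zs ++ xs)) ≡ pairs xs
filter-increasing zs [] _ _ = refl
filter-increasing zs (x ∷ xs) zs< (x< ∷ xs<) = begin
  filter lt? (map (x ,_) (zs ++ x ∷ xs) ++ cartesianProduct xs (zs ++ x ∷ xs))
    ≡⟨ cong (λ l → filter lt? (map (x ,_) l ++ cartesianProduct xs l)) (++-assoc zs [ x ] xs) ⟨
  filter lt? (map (x ,_) (zs′ ++ xs) ++ cartesianProduct xs (zs′ ++ xs))
    ≡⟨ cong (λ l → filter lt? (l ++ cartesianProduct xs (zs′ ++ xs))) (map-++ (x ,_) zs′ xs) ⟩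
  filter lt? ((map (x ,_) zs′ ++ map (x ,_) xs) ++ cartesianProduct xs (zs′ ++ xs))
    ≡⟨ filter-++ lt? (map (x ,_) zs′ ++ map (x ,_) xs) _ ⟩
  filter lt? (map (x ,_) zs′ ++ map (x ,_) xs) ++ filter lt? (cartesianProduct xs (zs′ ++ xs))
    ≡⟨ cong₂ _++_ row (filter-increasing zs′ xs (Allₚ.++⁺ (All.map All.tail zs<) (x< ∷ [])) xs<) ⟩
  map (x ,_) xs ++ pairs xs ∎
  where
  open ≡.≡-Reasoning
  zs′ = zs ++ [ x ]
  lt? = λ (p : Fin _ × Fin _) → proj₁ p <? proj₂ p

  row : filter lt? (map (x ,_) zs′ ++ map (x ,_) xs) ≡ map (x ,_) xs
  row = ≡.trans (filter-++ lt? (map (x ,_) zs′) _) (cong₂ _++_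
    (filter-none lt? (Allₚ.map⁺ (Allₚ.++⁺ (All.map (λ z< x<z → ℕₚ.<-asym x<z (All.head z<)) zs<) (ℕₚ.<-irrefl refl ∷ []))))
    (filter-all lt? (Allₚ.map⁺ x<)))

edges≡pairs : ∀ n → edges n ≡ pairs (allFin n)
edges≡pairs n = filter-increasing [] (allFin n) [] (AllPairsₚ.tabulate⁺-< (λ i<j → i<j))

sumOver : ∀ {k} → Subset k → (Fin k → ℕ) → ℕ
sumOver []            w = 0
sumOver (inside ∷ S)  w = w Fin.zero ℕ.+ sumOver S (w ∘ Fin.suc)
sumOver (outside ∷ S) w = sumOver S (w ∘ Fin.suc)

prefixSum : ∀ {k} → ℕ → (Fin k → ℕ) → ℕ
prefixSum {zero}  _       w = 0
prefixSum {suc k} zero    w = 0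
prefixSum {suc k} (suc ℓ) w = w Fin.zero ℕ.+ prefixSum ℓ (w ∘ Fin.suc)

Antitone : ∀ {k} → (Fin k → ℕ) → Set
Antitone w = ∀ {i j} → i Fin.≤ j → w j ℕ.≤ w i

prefixSum-shift : ∀ {k} ℓ {w : Fin (suc k) → ℕ} → Antitone w → prefixSum ℓ (w ∘ Fin.suc) ℕ.≤ prefixSum ℓ w
prefixSum-shift {zero}  ℓ       anti = z≤n
prefixSum-shift {suc k} zero    anti = z≤n
prefixSum-shift {suc k} (suc ℓ) anti = ℕₚ.+-mono-≤ (anti z≤n) (prefixSum-shift ℓ (anti ∘ s≤s))

-- If index 0 is left out of `S`, induction bounds the sum by a window of weights starting at index
-- 1; sliding that window back to index 0 cannot decrease its sum, as the weights are antitone.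
sumOver≤prefixSum : ∀ {k} (S : Subset k) {ℓ w} → Antitone w → ∣ S ∣ ℕ.≤ ℓ → sumOver S w ℕ.≤ prefixSum ℓ w
sumOver≤prefixSum [] anti _ = z≤n
sumOver≤prefixSum (inside ∷ S) anti (s≤s S≤) = ℕₚ.+-monoʳ-≤ _ (sumOver≤prefixSum S (anti ∘ s≤s) S≤)
sumOver≤prefixSum (outside ∷ S) {ℓ} anti S≤ =
  ℕₚ.≤-trans (sumOver≤prefixSum S (anti ∘ s≤s) S≤) (prefixSum-shift ℓ anti)

sumOver-mono-≤ : ∀ {k} (S : Subset k) {w w′} → (∀ i → w i ℕ.≤ w′ i) → sumOver S w ℕ.≤ sumOver S w′
sumOver-mono-≤ [] w≤ = z≤n
sumOver-mono-≤ (inside ∷ S) w≤ = ℕₚ.+-mono-≤ (w≤ Fin.zero) (sumOver-mono-≤ S (w≤ ∘ Fin.suc))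
sumOver-mono-≤ (outside ∷ S) w≤ = sumOver-mono-≤ S (w≤ ∘ Fin.suc)

sumOver-mono-< : ∀ {k} {S : Subset k} {w w′ c} → (∀ i → w i ℕ.≤ w′ i) → c ∈ˢ S → w c ℕ.< w′ c →
  sumOver S w ℕ.< sumOver S w′
sumOver-mono-< {S = inside ∷ S} w≤ here w< = ℕₚ.+-mono-<-≤ w< (sumOver-mono-≤ S (w≤ ∘ Fin.suc))
sumOver-mono-< {S = inside ∷ S} w≤ (there c∈) w< = ℕₚ.+-mono-≤-< (w≤ Fin.zero) (sumOver-mono-< (w≤ ∘ Fin.suc) c∈ w<)
sumOver-mono-< {S = outside ∷ S} w≤ (there c∈) w< = sumOver-mono-< (w≤ ∘ Fin.suc) c∈ w<

length-filter-∷ : {P : A → Set p} (P? : Decidable P) → ∀ x xs →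
  length (filter P? xs) ℕ.≤ length (filter P? (x ∷ xs))
length-filter-∷ P? x xs with does (P? x)
... | Bool.true  = ℕₚ.n≤1+n _
... | Bool.false = ℕₚ.≤-refl

-- A new element with value in `S` strictly raises the count of that value and lowers no other
-- count.
length-filter-∈ : ∀ {k} (g : A → Fin k) S xs →
  length (filter (λ x → g x ∈? S) xs) ℕ.≤ sumOver S (λ c → length (filter (λ x → g x ≟ c) xs))
length-filter-∈ g S [] = z≤n
length-filter-∈ g S (x ∷ xs) with g x ∈? S
... | yes gx∈ = ℕₚ.≤-<-trans (length-filter-∈ g S xs)
  (sumOver-mono-< (λ c → length-filter-∷ (λ y → g y ≟ c) x xs) gx∈
    (ℕₚ.≤-reflexive (≡.sym (cong length (filter-accept (λ y → g y ≟ g x) {xs = xs} refl)))))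
... | no _ = ℕₚ.≤-trans (length-filter-∈ g S xs)
  (sumOver-mono-≤ S (λ c → length-filter-∷ (λ y → g y ≟ c) x xs))

-- Integer sums and their counterparts in the naturals.

sum-inject≤ : ∀ {k} ℓ (ℓ≤k : ℓ ℕ.≤ k) {e : Fin k → ℤ} (w : Fin k → ℕ) → (∀ i → + w i ≡ e i) →
  sum (λ (i : Fin ℓ) → e (inject≤ i ℓ≤k)) ≡ + prefixSum ℓ w
sum-inject≤ {zero}  zero    _ w w≡e = refl
sum-inject≤ {suc k} zero    _ w w≡e = refl
sum-inject≤ {suc k} (suc ℓ) (s≤s ℓ≤k) w w≡e =
  cong₂ ℤ._+_ (≡.sym (w≡e Fin.zero)) (sum-inject≤ ℓ ℓ≤k (w ∘ Fin.suc) (w≡e ∘ Fin.suc))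

sum-nonpositive : ∀ {ℓ} (f : Fin ℓ → ℤ) → (∀ i → f i ℤ.≤ + 0) → sum f ℤ.≤ + 0
sum-nonpositive {zero}  f f≤ = ℤₚ.≤-refl
sum-nonpositive {suc ℓ} f f≤ = ℤₚ.+-mono-≤ (f≤ Fin.zero) (sum-nonpositive (f ∘ Fin.suc) (f≤ ∘ Fin.suc))

suc-minus-suc : ∀ m n → + suc m - + suc n ≡ + m - + n
suc-minus-suc m n = ≡.trans (ℤₚ.[1+m]⊖[1+n]≡m⊖n m n) (≡.sym (ℤₚ.m-n≡m⊖n m n))

ℤ-+-cancelʳ-≤ : ∀ t {i j} → i ℤ.+ t ℤ.≤ j ℤ.+ t → i ℤ.≤ j
ℤ-+-cancelʳ-≤ t {i} {j} i+t≤j+t = subst₂ ℤ._≤_ (drop i) (drop j) (ℤₚ.+-monoˡ-≤ (ℤ.- t) i+t≤j+t)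
  where
  drop : ∀ i → i ℤ.+ t - t ≡ i
  drop i = ≡.trans (ℤₚ.+-assoc i t (ℤ.- t)) (≡.trans (cong (λ s → i ℤ.+ s) (ℤₚ.+-inverseʳ t)) (ℤₚ.+-identityʳ i))

-- An inequality because the summands are negative from index m + 1 on, while m ∸ ℓ stays 0.
sum-descending : ∀ m ℓ →
  sum (λ (i : Fin ℓ) → + suc m - + suc (toℕ i)) ℤ.+ + triangle (m ℕ.∸ ℓ) ℤ.≤ + triangle m
sum-descending m zero = ℤₚ.≤-reflexive (ℤₚ.+-identityˡ _)
sum-descending zero (suc ℓ) = ℤₚ.≤-trans (ℤₚ.≤-reflexive (ℤₚ.+-identityʳ _))
  (sum-nonpositive {suc ℓ} (λ i → + 1 - + suc (toℕ i)) (λ i → ℤₚ.≤-trans (ℤₚ.≤-reflexive (suc-minus-suc 0 (toℕ i)))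
    (ℤₚ.≤-trans (ℤₚ.≤-reflexive (ℤₚ.+-identityˡ (ℤ.- + toℕ i))) (ℤₚ.neg-mono-≤ (ℤ.+≤+ (z≤n {toℕ i}))))))
sum-descending (suc m) (suc ℓ) = begin
  + suc m ℤ.+ sum (λ (i : Fin ℓ) → + suc (suc m) - + suc (suc (toℕ i))) ℤ.+ + triangle (m ℕ.∸ ℓ)
    ≡⟨ cong (λ s → + suc m ℤ.+ s ℤ.+ + triangle (m ℕ.∸ ℓ))
         (sum-cong-≗ {ℓ} (λ i → suc-minus-suc (suc m) (suc (toℕ i)))) ⟩
  + suc m ℤ.+ sum (λ (i : Fin ℓ) → + suc m - + suc (toℕ i)) ℤ.+ + triangle (m ℕ.∸ ℓ)
    ≡⟨ ℤₚ.+-assoc (+ suc m) (sum (λ (i : Fin ℓ) → + suc m - + suc (toℕ i))) _ ⟩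
  + suc m ℤ.+ (sum (λ (i : Fin ℓ) → + suc m - + suc (toℕ i)) ℤ.+ + triangle (m ℕ.∸ ℓ))
    ≤⟨ ℤₚ.+-monoʳ-≤ (+ suc m) (sum-descending m ℓ) ⟩
  + triangle (suc m) ∎
  where open ℤₚ.≤-Reasoning

-- Gallai decomposition

Inhabited : List A → Set _
Inhabited xs = ∃ (_∈ xs)

module Structure {V : Set} {k : ℕ} (col : V → V → Fin k)
  (col-sym : ∀ x y → col x y ≡ col y x)
  -- No distinctness of x, y, z: if two of them coincide, then so do two of the edges.
  (gallai : ∀ x y z → col x y ≢ col y z → col y z ≢ col x z → col x y ≡ col x z) where

  -- The test functions take values in `Fin k` because they are instantiated with the colours of the
  -- edges to a fixed vertex.
  Respects : (V → V → Set) → List V → (V → Fin k) → Set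
  Respects R X f = ∀ {x y} → x ∈ X → y ∈ X → R x y → f x ≡ f y

  -- Connectedness without paths: what is constant along edges is constant.
  Connected : (V → V → Set) → List V → Set
  Connected R X = ∀ f → Respects R X f → ∀ {x y} → x ∈ X → y ∈ X → f x ≡ f y

  connected-via : ∀ {R X} v → (∀ f → Respects R X f → ∀ {x} → x ∈ X → f x ≡ f v) → Connected R X
  connected-via v toV f resp x∈ y∈ = ≡.trans (toV f resp x∈) (≡.sym (toV f resp y∈))

  record Cross (D : Subset k) (A B : List V) : Set where
    constructor cross
    field
      at : ∀ {a b} → a ∈ A → b ∈ B → col a b ∈ˢ D

  open Cross

  Cross-sym : ∀ {D A B} → Cross D A B → Cross D B A
  Cross-sym {D} cr = cross λ b∈ a∈ → subst (_∈ˢ D) (col-sym _ _) (at cr a∈ b∈)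

  Cross-concat : ∀ {D A Bs} → All (Cross D A) Bs → Cross D A (concat Bs)
  Cross-concat {Bs = Bs} crs = cross λ a∈ b∈ →
    let _ , b∈B , B∈Bs = ∈-concat⁻′ Bs b∈ in at (All.lookup crs B∈Bs) a∈ b∈B

  Outside : Subset k → V → V → Set
  Outside D x y = col x y ∉ˢ D

  Touches : Subset k → V → List V → Set
  Touches D v = Any (Outside D v)

  -- The colour of yz lies outside `D`, hence differs from both colours at x; since the triangle is
  -- not rainbow, those two agree.
  gallai-∉ : ∀ {D x y z} → col y z ∉ˢ D → col x y ∈ˢ D → col x z ∈ˢ D → col x y ≡ col x z
  gallai-∉ {D} yz∉ xy∈ xz∈ = gallai _ _ _
    (λ eq → yz∉ (subst (_∈ˢ D) eq xy∈)) (λ eq → yz∉ (subst (_∈ˢ D) (≡.sym eq) xz∈))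

  gallai-∈ : ∀ {D x y z} → col y z ∈ˢ D → col x y ∉ˢ D → col x z ∉ˢ D → col x y ≡ col x z
  gallai-∈ {D} yz∈ xy∉ xz∉ = gallai _ _ _
    (λ eq → xy∉ (subst (_∈ˢ D) (≡.sym eq) yz∈)) (λ eq → xz∉ (subst (_∈ˢ D) eq yz∈))

  -- By `gallai-∉`, moving one end of a crossing edge along an edge outside `D` preserves its
  -- colour. Connectedness lets first the end in `A`, then the end in `B`, move anywhere in its
  -- part.
  cross-constant : ∀ {D A B} → Connected (Outside D) A → Connected (Outside D) B → Cross D A B →
    ∀ {a a′ b b′} → a ∈ A → a′ ∈ A → b ∈ B → b′ ∈ B → col a b ≡ col a′ b′
  cross-constant conA conB cr {a′ = a′} {b = b} a∈ a′∈ b∈ b′∈ = ≡.trans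
    (conA (λ u → col u b)
      (λ x∈ y∈ xy∉ → ≡.trans (col-sym _ _) (≡.trans
        (gallai-∉ xy∉ (at (Cross-sym cr) b∈ x∈) (at (Cross-sym cr) b∈ y∈)) (col-sym _ _)))
      a∈ a′∈)
    (conB (col a′) (λ x∈ y∈ xy∉ → gallai-∉ xy∉ (at cr a′∈ x∈) (at cr a′∈ y∈)) b∈ b′∈)

  Cross-[] : ∀ {D v B} → (∀ {b} → b ∈ B → col v b ∈ˢ D) → Cross D [ v ] B
  Cross-[] v-B = cross λ { (here refl) → v-B ; (there ()) }

  -- Components of the graph formed by the colours outside `D`.

  record Components (D : Subset k) (X : List V) : Set where
    constructor components
    field
      parts     : List (List V)
      perm      : X ↭ concat parts
      inhabited : All Inhabited parts
      connected : All (Connected (Outside D)) parts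
      separated : AllPairs (Cross D) parts


  open Components

  -- What a new vertex v does to the components: those in `near` have an edge to v with colour
  -- outside `D` and merge with v into one component, the hub; those in `far` survive unchanged.
  record Neighbourhood {D X} (c : Components D X) (v : V) : Set where
    constructor neighbourhood
    field
      near far      : List (List V)
      parts↭        : parts c ↭ near ++ far
      touched       : All (Touches D v) near
      hub-connected : Connected (Outside D) (v ∷ concat near)
      hub-far       : All (Cross D (v ∷ concat near)) far

  neighbourhood-of : ∀ {D X} (c : Components D X) v → Neighbourhood c v
  neighbourhood-of {D} c v
    with separate (λ P → Any.any? (λ w → ¬? (col v w ∈? D)) P) (parts c)
  ... | near , far , parts↭ , touched , untouched = neighbourhood near far parts↭ touched
    (connected-via v hub)
    (All.zipWith (λ (¬touch , crs) → hub-cross ¬touch crs)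
      (untouched , swapAll far (proj₂ (proj₂ (AllPairs-++⁻ near seps)))))
    where
    seps = AllPairs-resp-↭ Cross-sym parts↭ (separated c)
    conns = Allₚ.++⁻ˡ near (All-resp-↭ parts↭ (connected c))

    swapAll : ∀ far → All (λ P → All (Cross D P) far) near → All (λ U → All (Cross D U) near) far
    swapAll [] _ = []
    swapAll (U ∷ far) crs = All.map (λ cr → Cross-sym (All.head cr)) crs ∷ swapAll far (All.map All.tail crs)

    hub-cross : ∀ {U} → ¬ Touches D v U → All (Cross D U) near → Cross D (v ∷ concat near) U
    hub-cross ¬touch crs = cross λ
      { (here refl) u∈ → decidable-stable (_ ∈? D) (λ vu∉ → ¬touch (lose u∈ vu∉))
      ; (there w∈) u∈ → at (Cross-sym (Cross-concat crs)) w∈ u∈ }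

    hub : ∀ f → Respects (Outside D) (v ∷ concat near) f → ∀ {x} → x ∈ v ∷ concat near → f x ≡ f v
    hub f resp (here refl) = refl
    hub f resp (there x∈) with ∈-concat⁻′ near x∈
    -- The vertex x is linked within its part to some y, and y is adjacent to v by an edge with
    -- colour outside `D`.
    ... | P , x∈P , P∈ with find (All.lookup touched P∈)
    ... | y , y∈P , vy∉ = ≡.trans
      (All.lookup conns P∈ f (λ u∈ w∈ → resp (there (∈-concat⁺′ u∈ P∈)) (there (∈-concat⁺′ w∈ P∈))) x∈P y∈P)
      (≡.sym (resp (here refl) (there (∈-concat⁺′ y∈P P∈)) vy∉))

  attach-perm : ∀ {D X} (c : Components D X) v (N : Neighbourhood c v) → let open Neighbourhood N in
    v ∷ X ↭ (v ∷ concat near) ++ concat far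
  attach-perm c v (neighbourhood near far parts↭ _ _ _) = prep v
    (↭-trans (perm c) (↭-trans (concat⁺ parts↭) (↭-reflexive (≡.sym (concat-++ near far)))))

  attach : ∀ {D X} → Components D X → ∀ v → Components D (v ∷ X)
  attach c v with neighbourhood-of c v
  ... | N@(neighbourhood near far parts↭ touched hub-conn hub-far) = components
    ((v ∷ concat near) ∷ far)
    (attach-perm c v N)
    ((v , here refl) ∷ Allₚ.++⁻ʳ near (All-resp-↭ parts↭ (inhabited c)))
    (hub-conn ∷ Allₚ.++⁻ʳ near (All-resp-↭ parts↭ (connected c)))
    (hub-far ∷ proj₁ (proj₂ (AllPairs-++⁻ near (AllPairs-resp-↭ Cross-sym parts↭ (separated c)))))

  components-of : ∀ D X → Components D X
  components-of D [] = components [] refl [] [] []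
  components-of D (v ∷ X) = attach (components-of D X) v

  join : ∀ {D A B} → Components D A → Components D B → Cross D A B → Components D (A ++ B)
  join {D} cA cB cr = components
    (parts cA ++ parts cB)
    (↭-trans (++⁺ (perm cA) (perm cB)) (↭-reflexive (concat-++ (parts cA) (parts cB))))
    (Allₚ.++⁺ (inhabited cA) (inhabited cB))
    (Allₚ.++⁺ (connected cA) (connected cB))
    (AllPairsₚ.++⁺ (separated cA) (separated cB)
      (All.tabulate λ P∈ → All.tabulate λ Q∈ → cross λ a∈ b∈ → at cr
        (∈-resp-↭ (↭-sym (perm cA)) (∈-concat⁺′ a∈ P∈))
        (∈-resp-↭ (↭-sym (perm cB)) (∈-concat⁺′ b∈ Q∈))))

  reorder : ∀ {D X Y} → X ↭ Y → Components D Y → Components D X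
  reorder X↭Y c = components (parts c) (↭-trans X↭Y (perm c)) (inhabited c) (connected c) (separated c)

  parts-nonempty : ∀ {D X} (c : Components D X) → Inhabited X → 1 ℕ.≤ length (parts c)
  parts-nonempty (components [] X↭ _ _ _) (x , x∈) with () ← ∈-resp-↭ X↭ x∈
  parts-nonempty (components (_ ∷ _) _ _ _ _) _ = s≤s z≤n

  -- Gallai splits and their extension by one vertex.

  data Split (X : List V) : Set where
    two : ∀ {A B} c → Inhabited A → Inhabited B → X ↭ A ++ B →
      (∀ {a b} → a ∈ A → b ∈ B → col a b ≡ c) → Split X
    three : ∀ {A B C} D → ∣ D ∣ ℕ.≤ 2 → Inhabited A → Inhabited B → Inhabited C → X ↭ A ++ B ++ C →
      Cross D A (B ++ C) → Cross D B C → Split X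

  pair : Fin k → Fin k → Subset k
  pair c d = ⁅ c ⁆ ∪ ⁅ d ⁆

  ∣pair∣≤2 : ∀ c d → ∣ pair c d ∣ ℕ.≤ 2
  ∣pair∣≤2 c d = ℕₚ.≤-trans (∣p∪q∣≤∣p∣+∣q∣ ⁅ c ⁆ ⁅ d ⁆)
    (ℕₚ.≤-reflexive (cong₂ ℕ._+_ (∣⁅x⁆∣≡1 c) (∣⁅x⁆∣≡1 d)))

  ∈-pairˡ : ∀ {x c d} → x ≡ c → x ∈ˢ pair c d
  ∈-pairˡ {c = c} refl = x∈p∪q⁺ (inj₁ (x∈⁅x⁆ c))

  ∈-pairʳ : ∀ {x c d} → x ≡ d → x ∈ˢ pair c d
  ∈-pairʳ {d = d} refl = x∈p∪q⁺ (inj₂ (x∈⁅x⁆ d))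

  Cross-++ʳ : ∀ {D A} B {C} → Cross D A B → Cross D A C → Cross D A (B ++ C)
  Cross-++ʳ B crB crC = cross λ a∈ x∈ → [ at crB a∈ , at crC a∈ ]′ (∈-++⁻ B x∈)

  -- If v sends only c to one side, it joins the other side. Otherwise it sends colours different
  -- from c to both sides, and the triangles on v and a crossing edge, which has colour c, force all
  -- of these to be equal; then v, `A` and `B` are joined by two colours.
  mono-grow : ∀ {X A B} c → Inhabited A → Inhabited B → X ↭ A ++ B →
    (∀ {a b} → a ∈ A → b ∈ B → col a b ≡ c) → ∀ v → Split (v ∷ X)
  mono-grow {X} {A} {B} c iA iB X↭ cr v
    with All.all? (λ a → col v a ≟ c) A | All.all? (λ b → col v b ≟ c) B
  ... | yes vA | _ = two c iA (v , here refl) (↭-trans (prep v X↭) (↭-sym (shift v A B))) λ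
    { a∈ (here refl) → ≡.trans (col-sym _ _) (All.lookup vA a∈) ; a∈ (there b∈) → cr a∈ b∈ }
  ... | no _ | yes vB = two c (v , here refl) iB (prep v X↭) λ
    { (here refl) b∈ → All.lookup vB b∈ ; (there a∈) b∈ → cr a∈ b∈ }
  ... | no ¬vA | no ¬vB
    with find (Allₚ.¬All⇒Any¬ (λ a → col v a ≟ c) A ¬vA) | find (Allₚ.¬All⇒Any¬ (λ b → col v b ≟ c) B ¬vB)
  ... | a , a∈ , va≢c | b , b∈ , vb≢c =
    three {A = [ v ]} {A} {B} (pair c (col v a)) (∣pair∣≤2 c (col v a)) (v , here refl) iA iB (prep v X↭)
      (Cross-++ʳ A (Cross-[] v-A) (Cross-[] v-B))
      (cross λ x∈ y∈ → ∈-pairˡ (cr x∈ y∈))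
    where
    exchange : ∀ {x y} → x ∈ A → y ∈ B → col v x ≢ c → col v y ≢ c → col v x ≡ col v y
    exchange x∈ y∈ vx≢c vy≢c = gallai _ _ _
      (λ eq → vx≢c (≡.trans eq (cr x∈ y∈))) (λ eq → vy≢c (≡.trans (≡.sym eq) (cr x∈ y∈)))

    v-A : ∀ {x} → x ∈ A → col v x ∈ˢ pair c (col v a)
    v-A {x} x∈ with col v x ≟ c
    ... | yes eq = ∈-pairˡ eq
    ... | no neq = ∈-pairʳ (≡.trans (exchange x∈ b∈ neq vb≢c) (≡.sym (exchange a∈ b∈ va≢c vb≢c)))

    v-B : ∀ {y} → y ∈ B → col v y ∈ˢ pair c (col v a)
    v-B {y} y∈ with col v y ≟ c
    ... | yes eq = ∈-pairˡ eq
    ... | no neq = ∈-pairʳ (≡.sym (exchange a∈ y∈ va≢c neq))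

  -- Here the graph of the colours outside D becomes connected when v is added.
  -- All its edges at v then have one colour t, and if z is joined to v by another
  -- colour s, every edge between the part Z of z and the other parts has colour s.
  dominating-grow : ∀ {D X} (c : Components D X) v → All (Touches D v) (parts c) →
    2 ℕ.≤ length (parts c) → Split (v ∷ X)
  dominating-grow (components (_ ∷ []) _ _ _ _) v _ (s≤s ())
  dominating-grow {D} {X} (components (P ∷ Q ∷ ps) X↭ inh conn sep@(sepP ∷ _)) v touch@(touchP ∷ touchQ ∷ _) _
    with find touchP | find touchQ
  ... | x , x∈ , vx∉ | y , y∈ , vy∉ = result
    where
    all-parts = P ∷ Q ∷ ps
    t = col v x

    -- A vertex outside `P` is compared with x directly, since they are joined by a colour in `D`; a
    -- vertex of `P` is compared with x by way of y in `Q`.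
    outside-t : ∀ {w} → w ∈ concat all-parts → col v w ∉ˢ D → col v w ≡ t
    outside-t w∈ vw∉ with ∈-++⁻ P w∈
    ... | inj₁ w∈P = ≡.trans (gallai-∈ (at (All.head sepP) w∈P y∈) vw∉ vy∉)
      (≡.sym (gallai-∈ (at (All.head sepP) x∈ y∈) vx∉ vy∉))
    ... | inj₂ w∈r = ≡.sym (gallai-∈ (at (Cross-concat sepP) x∈ w∈r) vx∉ vw∉)

    around : ∀ {z Z Qs} → z ∈ Z → col v z ≢ t → all-parts ↭ Z ∷ Qs → Split (v ∷ X)
    around {Qs = []} _ _ ps↭ with () ← ↭-length ps↭
    around {z} {Z} {Qs@(Q₁ ∷ Qs′)} z∈ vz≢t ps↭
      with All-resp-↭ ps↭ touch | All-resp-↭ ps↭ inh | All-resp-↭ ps↭ conn | AllPairs-resp-↭ Cross-sym ps↭ sep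
    ... | touchZ ∷ touchQs | _ ∷ (q₁ , q₁∈) ∷ _ | connZ ∷ connQs | sepZ ∷ _ =
      three {A = [ v ]} {Z} {concat Qs} (pair t s) (∣pair∣≤2 t s) (v , here refl) (z , z∈) (q₁ , ∈-++⁺ˡ q₁∈)
        (prep v (↭-trans X↭ (concat⁺ ps↭)))
        (Cross-++ʳ Z (Cross-[] v-Z) (Cross-[] v-Qs))
        (cross λ a∈ b∈ → ∈-pairʳ (Z-Qs a∈ b∈))
      where
      s = col v z

      in-parts : ∀ {w} → w ∈ concat (Z ∷ Qs) → w ∈ concat all-parts
      in-parts = ∈-resp-↭ (concat⁺ (↭-sym ps↭))

      s∈D : s ∈ˢ D
      s∈D = decidable-stable (s ∈? D) (λ vz∉ → vz≢t (outside-t (in-parts (∈-++⁺ˡ z∈)) vz∉))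

      -- Each other part `R` has some r with vr outside `D`, so the triangle z, v, r gives zr the
      -- colour s of zv; `cross-constant` spreads s to all edges between `Z` and `R`.
      Z-Qs : ∀ {a b} → a ∈ Z → b ∈ concat Qs → col a b ≡ s
      Z-Qs a∈ b∈ with ∈-concat⁻′ Qs b∈
      ... | R , b∈R , R∈ with find (All.lookup touchQs R∈)
      ... | r , r∈ , vr∉ = ≡.trans
        (cross-constant connZ (All.lookup connQs R∈) (All.lookup sepZ R∈) a∈ z∈ b∈R r∈)
        (≡.trans (≡.sym (gallai-∉ vr∉ (subst (_∈ˢ D) (col-sym v z) s∈D) (at (All.lookup sepZ R∈) z∈ r∈))) (col-sym z v))

      -- If vw is outside `D`, its colour is t. Otherwise the triangle w, v, u, whose edge vu is
      -- outside `D`, makes vw agree with wu.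
      v-via : ∀ {w u} → w ∈ concat (Z ∷ Qs) → col v u ∉ˢ D → col w u ≡ s → col v w ∈ˢ pair t s
      v-via {w} {u} w∈ vu∉ wu≡s with col v w ∈? D
      ... | no vw∉ = ∈-pairˡ (outside-t (in-parts w∈) vw∉)
      ... | yes vw∈ = ∈-pairʳ (≡.trans (col-sym v w) (≡.trans
        (gallai-∉ vu∉ (subst (_∈ˢ D) (col-sym v w) vw∈) (subst (_∈ˢ D) (≡.sym wu≡s) s∈D)) wu≡s))

      v-Z : ∀ {w} → w ∈ Z → col v w ∈ˢ pair t s
      v-Z w∈ with find (All.head touchQs)
      ... | u , u∈ , vu∉ = v-via (∈-++⁺ˡ w∈) vu∉ (Z-Qs w∈ (∈-++⁺ˡ u∈))

      v-Qs : ∀ {w} → w ∈ concat Qs → col v w ∈ˢ pair t s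
      v-Qs w∈ with find touchZ
      ... | u , u∈ , vu∉ = v-via (∈-++⁺ʳ Z w∈) vu∉ (≡.trans (col-sym _ _) (Z-Qs u∈ w∈))

    result : Split (v ∷ X)
    result with All.all? (λ w → col v w ≟ t) (concat all-parts)
    ... | yes vt = two {A = [ v ]} t (v , here refl) (x , ∈-++⁺ˡ x∈) (prep v X↭)
      λ { (here refl) b∈ → All.lookup vt b∈ ; (there ()) }
    ... | no ¬vt with find (Allₚ.¬All⇒Any¬ (λ w → col v w ≟ t) (concat all-parts) ¬vt)
    ... | z , z∈ , vz≢t with ∈-concat⁻′ all-parts z∈
    ... | Z , z∈Z , Z∈ with ∈-∃++ Z∈
    ... | as , bs , eq = around z∈Z vz≢t (↭-trans (↭-reflexive eq) (shift Z as bs))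

  -- Cases on the components that v does not touch. With none, v dominates; with one,
  -- `cross-constant` makes a single colour join it to the hub; with more, the hub, one of them and
  -- the union of the rest are joined by `D`.
  components-grow : ∀ {D X} → ∣ D ∣ ℕ.≤ 2 → (c : Components D X) → 2 ℕ.≤ length (parts c) →
    ∀ v → Split (v ∷ X)
  components-grow {D} {X} ∣D∣≤2 c 2≤ v with neighbourhood-of c v
  ... | N@(neighbourhood near far parts↭ touched hub-conn hub-far) =
    go far parts↭ hub-far (attach-perm c v N)
    where
    go : ∀ far → parts c ↭ near ++ far → All (Cross D (v ∷ concat near)) far →
      v ∷ X ↭ (v ∷ concat near) ++ concat far → Split (v ∷ X)
    go [] parts↭ _ _ = dominating-grow c v
      (All-resp-↭ (↭-trans (↭-reflexive (≡.sym (++-identityʳ near))) (↭-sym parts↭)) touched) 2≤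
    go (U ∷ []) parts↭ (hub-U ∷ []) X↭
      with Allₚ.++⁻ʳ near (All-resp-↭ parts↭ (inhabited c)) | Allₚ.++⁻ʳ near (All-resp-↭ parts↭ (connected c))
    ... | (u , u∈) ∷ [] | connU ∷ [] = two (col v u) (v , here refl) (u , u∈)
      (subst (λ Y → v ∷ X ↭ (v ∷ concat near) ++ Y) (++-identityʳ U) X↭)
      (λ a∈ b∈ → cross-constant hub-conn connU hub-U a∈ (here refl) b∈ u∈)
    go (U ∷ W ∷ Ws) parts↭ (hub-U ∷ hub-Ws) X↭
      with Allₚ.++⁻ʳ near (All-resp-↭ parts↭ (inhabited c))
         | proj₁ (proj₂ (AllPairs-++⁻ near (AllPairs-resp-↭ Cross-sym parts↭ (separated c))))
    ... | iU ∷ (w , w∈) ∷ _ | sepU ∷ _ = three D ∣D∣≤2 (v , here refl) iU (w , ∈-++⁺ˡ w∈) X↭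
      (Cross-++ʳ U hub-U (Cross-concat hub-Ws)) (Cross-concat sepU)

  -- The parts of a `three` split may be disconnected outside `D`, so each is first refined into
  -- components. `A` and `B ++ C` contribute at least one each, hence two in total.
  split-grow : ∀ {X} → Split X → ∀ v → Split (v ∷ X)
  split-grow (two c iA iB X↭ cr) v = mono-grow c iA iB X↭ cr v
  split-grow (three {A} {B} {C} D ∣D∣≤2 iA iB iC X↭ crA crB) v =
    components-grow ∣D∣≤2 (reorder X↭ joined)
      (subst (2 ℕ.≤_) (≡.sym (length-++ (parts cA)))
        (ℕₚ.+-mono-≤ (parts-nonempty cA iA)
          (parts-nonempty cBC (proj₁ iB , ∈-++⁺ˡ (proj₂ iB))))) v
    where
    cA = components-of D A
    cBC = join (components-of D B) (components-of D C) crB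
    joined = join cA cBC crA

  split : ∀ v w X → Split (v ∷ w ∷ X)
  split v w [] = two {A = [ v ]} {[ w ]} (col v w) (v , here refl) (w , here refl) refl
    λ { (here refl) (here refl) → refl ; (there ()) ; _ (there ()) }
  split v w (x ∷ X) = split-grow (split w x X) v

  -- Few colours covering many edges

  miss : Subset k → Fin k → ℕ
  miss S c = if does (c ∈? S) then 0 else 1

  missDegree : Subset k → V → List V → ℕ
  missDegree S v X = ListAction.sum (map (λ x → miss S (col v x)) X)

  misses : Subset k → List V → ℕ
  misses S []      = 0
  misses S (v ∷ X) = missDegree S v X ℕ.+ misses S X

  miss-≤1 : ∀ S c → miss S c ℕ.≤ 1
  miss-≤1 S c with c ∈? S
  ... | yes _ = z≤n
  ... | no _ = ℕₚ.≤-refl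

  miss-∈ : ∀ {S c} → c ∈ˢ S → miss S c ≡ 0
  miss-∈ {S} {c} c∈ with c ∈? S
  ... | yes _ = refl
  ... | no c∉ = contradiction c∈ c∉

  miss-antitone : ∀ {S T} → S ⊆ T → ∀ c → miss T c ℕ.≤ miss S c
  miss-antitone {S} {T} S⊆T c with c ∈? S
  ... | yes c∈ = ℕₚ.≤-reflexive (miss-∈ (S⊆T c∈))
  ... | no _ = miss-≤1 T c

  missDegree-antitone : ∀ {S T} → S ⊆ T → ∀ v X → missDegree T v X ℕ.≤ missDegree S v X
  missDegree-antitone S⊆T v [] = z≤n
  missDegree-antitone S⊆T v (x ∷ X) =
    ℕₚ.+-mono-≤ (miss-antitone S⊆T (col v x)) (missDegree-antitone S⊆T v X)

  misses-antitone : ∀ {S T} → S ⊆ T → ∀ X → misses T X ℕ.≤ misses S X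
  misses-antitone S⊆T [] = z≤n
  misses-antitone S⊆T (v ∷ X) = ℕₚ.+-mono-≤ (missDegree-antitone S⊆T v X) (misses-antitone S⊆T X)

  missDegree-≤ : ∀ S v X → missDegree S v X ℕ.≤ length X
  missDegree-≤ S v [] = z≤n
  missDegree-≤ S v (x ∷ X) = ℕₚ.+-mono-≤ (miss-≤1 S (col v x)) (missDegree-≤ S v X)

  missDegree-< : ∀ S v {X x} → x ∈ X → col v x ∈ˢ S → missDegree S v X ℕ.< length X
  missDegree-< S v {_ ∷ X} (here refl) c∈ =
    s≤s (ℕₚ.≤-trans (ℕₚ.≤-reflexive (cong (ℕ._+ missDegree S v X) (miss-∈ c∈))) (missDegree-≤ S v X))
  missDegree-< S v {y ∷ X} (there x∈) c∈ = ℕₚ.≤-trans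
    (ℕₚ.≤-reflexive (≡.sym (ℕₚ.+-suc (miss S (col v y)) _)))
    (ℕₚ.+-mono-≤ (miss-≤1 S (col v y)) (missDegree-< S v x∈ c∈))

  missDegree-0 : ∀ {S} v X → (∀ {x} → x ∈ X → col v x ∈ˢ S) → missDegree S v X ≡ 0
  missDegree-0 v [] _ = refl
  missDegree-0 v (x ∷ X) all = cong₂ ℕ._+_ (miss-∈ (all (here refl))) (missDegree-0 v X (all ∘ there))

  missDegree-↭ : ∀ S v {X Y} → X ↭ Y → missDegree S v X ≡ missDegree S v Y
  missDegree-↭ S v X↭Y = sum-↭ (map⁺ _ X↭Y)

  missDegree-++ : ∀ S v X Y → missDegree S v (X ++ Y) ≡ missDegree S v X ℕ.+ missDegree S v Y
  missDegree-++ S v X Y = ≡.trans (cong ListAction.sum (map-++ _ X Y)) (sum-++ (map _ X) (map _ Y))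

  -- In the swap case the edge between the two heads passes from the count of one to that of the
  -- other, which is where symmetry of the colouring enters.
  misses-↭ : ∀ S {X Y} → X ↭ Y → misses S X ≡ misses S Y
  misses-↭ S refl = refl
  misses-↭ S (prep v p) = cong₂ ℕ._+_ (missDegree-↭ S v p) (misses-↭ S p)
  misses-↭ S (swap {X} {Y} v w p) = begin
    (miss S (col v w) ℕ.+ missDegree S v X) ℕ.+ (missDegree S w X ℕ.+ misses S X)
      ≡⟨ solve 4 (λ a b c d → (a :+ b) :+ (c :+ d) := (a :+ c) :+ (b :+ d)) refl
           (miss S (col v w)) (missDegree S v X) (missDegree S w X) (misses S X) ⟩
    (miss S (col v w) ℕ.+ missDegree S w X) ℕ.+ (missDegree S v X ℕ.+ misses S X)
      ≡⟨ cong₂ ℕ._+_ (cong₂ ℕ._+_ (cong (miss S) (col-sym v w)) (missDegree-↭ S w p))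
                     (cong₂ ℕ._+_ (missDegree-↭ S v p) (misses-↭ S p)) ⟩
    (miss S (col w v) ℕ.+ missDegree S w Y) ℕ.+ (missDegree S v Y ℕ.+ misses S Y) ∎
    where
    open ≡.≡-Reasoning
    open +-*-Solver
  misses-↭ S (trans p q) = ≡.trans (misses-↭ S p) (misses-↭ S q)

  misses-++ : ∀ S A B → Cross S A B → misses S (A ++ B) ≡ misses S A ℕ.+ misses S B
  misses-++ S [] B cr = refl
  misses-++ S (a ∷ A) B cr = begin
    missDegree S a (A ++ B) ℕ.+ misses S (A ++ B)
      ≡⟨ cong₂ ℕ._+_ (missDegree-++ S a A B) (misses-++ S A B (cross (at cr ∘ there))) ⟩
    missDegree S a A ℕ.+ missDegree S a B ℕ.+ (misses S A ℕ.+ misses S B)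
      ≡⟨ cong (λ d → missDegree S a A ℕ.+ d ℕ.+ (misses S A ℕ.+ misses S B)) (missDegree-0 a B (at cr (here refl))) ⟩
    missDegree S a A ℕ.+ 0 ℕ.+ (misses S A ℕ.+ misses S B)
      ≡⟨ cong (ℕ._+ (misses S A ℕ.+ misses S B)) (ℕₚ.+-identityʳ (missDegree S a A)) ⟩
    missDegree S a A ℕ.+ (misses S A ℕ.+ misses S B)
      ≡⟨ ℕₚ.+-assoc (missDegree S a A) _ _ ⟨
    missDegree S a A ℕ.+ misses S A ℕ.+ misses S B ∎
    where open ≡.≡-Reasoning

  misses-≤ : ∀ S v X → misses S (v ∷ X) ℕ.≤ triangle (length X)
  misses-≤ S v [] = z≤n
  misses-≤ S v (w ∷ X) = ℕₚ.+-mono-≤ (missDegree-≤ S v (w ∷ X)) (misses-≤ S w X)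

  -- If the colour c connects X and no edge from v has colour c, then all edges from v have
  -- one colour, which connects v ∷ X.
  connected-colour : ∀ v X → ∃[ c ]
    (Connected (λ x y → col x y ≡ c) (v ∷ X) × misses ⁅ c ⁆ (v ∷ X) ℕ.≤ triangle (ℕ.pred (length X)))
  -- A single vertex spans no edge; `col v v` is an arbitrary default colour.
  connected-colour v [] = col v v , (λ { f _ (here refl) (here refl) → refl }) , z≤n
  connected-colour v (w ∷ X) with connected-colour w X
  ... | c , conn , few with Any.any? (λ x → col v x ≟ c) (w ∷ X)
  ... | yes hit with find hit
  -- The edge vx has colour c, so at most `length X` of the `suc (length X)` edges at v are missed.
  ... | x , x∈ , vx≡c = c , connected-via v toV , bound X few
    (ℕₚ.≤-pred (missDegree-< ⁅ c ⁆ v x∈ (subst (_∈ˢ ⁅ c ⁆) (≡.sym vx≡c) (x∈⁅x⁆ c))))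
    where
    toV : ∀ f → Respects (λ x y → col x y ≡ c) (v ∷ w ∷ X) f → ∀ {y} → y ∈ v ∷ w ∷ X → f y ≡ f v
    toV f resp (here refl) = refl
    toV f resp (there y∈) = ≡.trans
      (conn f (λ a∈ b∈ → resp (there a∈) (there b∈)) y∈ x∈) (≡.sym (resp (here refl) (there x∈) vx≡c))

    bound : ∀ X {d m} → m ℕ.≤ triangle (ℕ.pred (length X)) → d ℕ.≤ length X → d ℕ.+ m ℕ.≤ triangle (length X)
    bound [] z≤n z≤n = z≤n
    bound (_ ∷ X) m≤ d≤ = ℕₚ.+-mono-≤ d≤ m≤
  -- No edge at v is missed, so all edges avoiding v can be conceded.
  connected-colour v (w ∷ X) | c , conn , few | no miss-c = d , connected-via v toV ,
    ℕₚ.+-mono-≤ (ℕₚ.≤-reflexive (missDegree-0 v (w ∷ X) λ x∈ → subst (_∈ˢ ⁅ d ⁆) (≡.sym (star x∈)) (x∈⁅x⁆ d)))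
      (misses-≤ ⁅ d ⁆ w X)
    where
    d = col v w

    star : ∀ {x} → x ∈ w ∷ X → col v x ≡ d
    star x∈ = conn (col v) (λ a∈ b∈ ab≡c → gallai _ _ _
      (λ eq → miss-c (lose a∈ (≡.trans eq ab≡c)))
      (λ eq → miss-c (lose b∈ (≡.trans (≡.sym eq) ab≡c)))) x∈ (here refl)

    toV : ∀ f → Respects (λ x y → col x y ≡ d) (v ∷ w ∷ X) f → ∀ {y} → y ∈ v ∷ w ∷ X → f y ≡ f v
    toV f resp (here refl) = refl
    toV f resp (there y∈) = ≡.sym (resp (here refl) (there y∈) (star y∈))

  -- D holds the colours joining b + 1 merged parts. They are not charged here: they fit
  -- into the final budget as soon as ∣ D ∣ ≤ b.
  record Coverable (D : Subset k) (b : ℕ) (X : List V) : Set where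
    constructor coverable
    field
      extra : ℕ
      size  : length X ≡ suc (b ℕ.+ extra)
      cover : ∀ ℓ j → ℓ ℕ.+ j ≡ extra → ∃[ S ] (∣ S ∣ ℕ.≤ ℓ × misses (D ∪ S) X ℕ.≤ triangle j)

  -- Adding the colours of `D` to a chosen set can only reduce the number of missed edges.
  weaken : ∀ {D X} → Coverable ∅ 0 X → Coverable D 0 X
  weaken {D} {X} (coverable extra size cover) = coverable extra size λ ℓ j eq →
    let S , S≤ , few = cover ℓ j eq in
    S , S≤ , ℕₚ.≤-trans
      (misses-antitone (λ x∈ → q⊆p∪q D S (subst (_ ∈ˢ_) (∪-identityˡ S) x∈)) X) few

  -- The crossing edges have colours in `D` and are never missed. The budget is split by
  -- `interpolate`, and the two bounds on missed edges combine by superadditivity of `triangle`.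
  -- Parts b + 1 and c + 1 in number give b + c + 2, hence the index `suc (b + c)`.
  merge : ∀ {D b c A B} → Coverable D b A → Coverable D c B → Cross D A B → Coverable D (suc (b ℕ.+ c)) (A ++ B)
  merge {D} {b} {c} {A} {B} (coverable a₁ size₁ cover₁) (coverable a₂ size₂ cover₂) cr =
    coverable (a₁ ℕ.+ a₂) size merged
    where
    size : length (A ++ B) ≡ suc (suc (b ℕ.+ c) ℕ.+ (a₁ ℕ.+ a₂))
    size = begin
      length (A ++ B)                       ≡⟨ length-++ A ⟩
      length A ℕ.+ length B                 ≡⟨ cong₂ ℕ._+_ size₁ size₂ ⟩
      suc (b ℕ.+ a₁) ℕ.+ suc (c ℕ.+ a₂)     ≡⟨ solve 4 (λ b c a₁ a₂ →
          con 1 :+ (b :+ a₁) :+ (con 1 :+ (c :+ a₂)) := con 2 :+ (b :+ c) :+ (a₁ :+ a₂)) refl b c a₁ a₂ ⟩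
      suc (suc (b ℕ.+ c) ℕ.+ (a₁ ℕ.+ a₂))   ∎
      where
      open ≡.≡-Reasoning
      open +-*-Solver

    merged : ∀ ℓ j → ℓ ℕ.+ j ≡ a₁ ℕ.+ a₂ → ∃[ S ] (∣ S ∣ ℕ.≤ ℓ × misses (D ∪ S) (A ++ B) ℕ.≤ triangle j)
    merged ℓ j eq with interpolate a₁ a₂ {ℓ} {j} eq
    ... | ℓ₁ , j₁ , ℓ₂ , j₂ , eq₁ , eq₂ , refl , refl with cover₁ ℓ₁ j₁ eq₁ | cover₂ ℓ₂ j₂ eq₂
    ... | S , S≤ , fewA | T , T≤ , fewB =
      S ∪ T , ℕₚ.≤-trans (∣p∪q∣≤∣p∣+∣q∣ S T) (ℕₚ.+-mono-≤ S≤ T≤) , (begin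
        misses (D ∪ (S ∪ T)) (A ++ B)
          ≡⟨ misses-++ _ A B (cross λ a∈ b∈ → p⊆p∪q (S ∪ T) (at cr a∈ b∈)) ⟩
        misses (D ∪ (S ∪ T)) A ℕ.+ misses (D ∪ (S ∪ T)) B
          ≤⟨ ℕₚ.+-mono-≤ (misses-antitone (enlarge (p⊆p∪q T)) A) (misses-antitone (enlarge (q⊆p∪q S T)) B) ⟩
        misses (D ∪ S) A ℕ.+ misses (D ∪ T) B  ≤⟨ ℕₚ.+-mono-≤ fewA fewB ⟩
        triangle j₁ ℕ.+ triangle j₂            ≤⟨ triangle-superadditive j₁ j₂ ⟩
        triangle (j₁ ℕ.+ j₂)                   ∎)
      where
      open ℕₚ.≤-Reasoning
      enlarge : ∀ {U W} → U ⊆ W → D ∪ U ⊆ D ∪ W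
      enlarge {U} U⊆W x∈ = x∈p∪q⁺ ([ inj₁ , inj₂ ∘ U⊆W ]′ (x∈p∪q⁻ D U x∈))

  ∅∪-⊇ : {S : Subset k} → S ⊆ ∅ ∪ S
  ∅∪-⊇ {S} = q⊆p∪q ∅ S

  cover-0 : ∀ X {j} → length X ≡ suc j → ∃[ S ] (∣ S ∣ ℕ.≤ 0 × misses (∅ ∪ S) X ℕ.≤ triangle j)
  cover-0 (v ∷ X) refl = ∅ , ℕₚ.≤-reflexive (∣⊥∣≡0 k) , misses-≤ _ v X

  -- Serves the budget of one colour, which cannot pay for two joining colours.
  cover-1 : ∀ X {j} → length X ≡ suc (suc j) → ∃[ S ] (∣ S ∣ ℕ.≤ 1 × misses (∅ ∪ S) X ℕ.≤ triangle j)
  cover-1 (v ∷ w ∷ X) refl with connected-colour v (w ∷ X)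
  ... | c , _ , few = ⁅ c ⁆ , ℕₚ.≤-reflexive (∣⁅x⁆∣≡1 c) , ℕₚ.≤-trans (misses-antitone ∅∪-⊇ (v ∷ w ∷ X)) few

  -- Here the joining colours are paid for: b of the b + ℓ colours go to `D`, the other ℓ to the set
  -- chosen inside the parts.
  cover-D : ∀ {D b X Y} → ∣ D ∣ ℕ.≤ b → X ↭ Y → (K : Coverable D b Y) → ∀ ℓ j →
    ℓ ℕ.+ j ≡ Coverable.extra K → ∃[ S ] (∣ S ∣ ℕ.≤ b ℕ.+ ℓ × misses (∅ ∪ S) X ℕ.≤ triangle j)
  cover-D {D} {X = X} {Y} ∣D∣≤b X↭Y K ℓ j eq with Coverable.cover K ℓ j eq
  ... | S , S≤ , few = D ∪ S , ℕₚ.≤-trans (∣p∪q∣≤∣p∣+∣q∣ D S) (ℕₚ.+-mono-≤ ∣D∣≤b S≤) ,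
    ℕₚ.≤-trans (misses-antitone ∅∪-⊇ X) (ℕₚ.≤-trans (ℕₚ.≤-reflexive (misses-↭ (D ∪ S) X↭Y)) few)

  inhabited-++ˡ : ∀ {A B : List V} → Inhabited A → Inhabited (A ++ B)
  inhabited-++ˡ (x , x∈) = x , ∈-++⁺ˡ x∈

  proper-part : ∀ {X A B : List V} {m} → X ↭ A ++ B → Inhabited B → length X ℕ.≤ suc m → length A ℕ.≤ m
  proper-part {X} {A} {B@(b ∷ B′)} {m} X↭ _ X≤ = ℕₚ.≤-pred (begin
    suc (length A)               ≤⟨ s≤s (ℕₚ.m≤m+n (length A) (length B′)) ⟩
    suc (length A ℕ.+ length B′) ≡⟨ ℕₚ.+-suc (length A) (length B′) ⟨
    length A ℕ.+ length B        ≡⟨ length-++ A ⟨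
    length (A ++ B)              ≡⟨ ↭-length X↭ ⟨
    length X                     ≤⟨ X≤ ⟩
    suc m                        ∎)
    where open ℕₚ.≤-Reasoning

  -- The bound m on the length makes the recursion on the parts of a split structural. Budgets too
  -- small for the joining colours are treated separately.
  coverable-≤ : ∀ m X → Inhabited X → length X ℕ.≤ m → Coverable ∅ 0 X
  coverable-≤ (suc m) (v ∷ []) _ _ = coverable 0 refl λ { zero _ refl → cover-0 [ v ] refl }
  coverable-≤ (suc m) X@(v ∷ w ∷ X′) _ X≤ with split v w X′
  ... | two {A} {B} c iA iB X↭ cr = coverable (suc extra) size′ λ
    { zero _ refl → cover-0 X size′
    ; (suc ℓ) j eq → cover-D (ℕₚ.≤-reflexive (∣⁅x⁆∣≡1 c)) X↭ K ℓ j (ℕₚ.suc-injective eq) }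
    where
    K = merge
      (weaken (coverable-≤ m A iA (proper-part {A = A} X↭ iB X≤)))
      (weaken (coverable-≤ m B iB (proper-part {A = B} (↭-trans X↭ (++-comm A B)) iA X≤)))
      (cross λ a∈ b∈ → subst (_∈ˢ ⁅ c ⁆) (≡.sym (cr a∈ b∈)) (x∈⁅x⁆ c))
    open Coverable K

    size′ = ≡.trans (↭-length X↭) size
  ... | three {A} {B} {B′} D ∣D∣≤2 iA iB iB′ X↭ crA crB = coverable (suc (suc extra)) size′ λ
    { zero _ refl → cover-0 X size′
    ; (suc zero) _ refl → cover-1 X size′
    ; (suc (suc ℓ)) j eq → cover-D ∣D∣≤2 X↭ K ℓ j (ℕₚ.suc-injective (ℕₚ.suc-injective eq)) }
    where
    K = merge
      (weaken (coverable-≤ m A iA (proper-part {A = A} X↭ (inhabited-++ˡ iB) X≤)))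
      (merge
        (weaken (coverable-≤ m B iB (proper-part {A = B} (↭-trans X↭ (shifts A B)) (inhabited-++ˡ iA) X≤)))
        (weaken (coverable-≤ m B′ iB′ (proper-part {A = B′}
          (↭-trans X↭ (↭-trans (++⁺ˡ A (++-comm B B′)) (shifts A B′))) (inhabited-++ˡ iA) X≤)))
        crB)
      crA
    open Coverable K

    size′ = ≡.trans (↭-length X↭) size

  -- From missed edges back to edge counts.

  hits+misses : ∀ S X →
    length (filter (λ p → col (proj₁ p) (proj₂ p) ∈? S) (pairs X)) ℕ.+ misses S X ≡ length (pairs X)
  hits+misses S [] = refl
  hits+misses S (v ∷ X) = begin
    length (filter hit? (map (v ,_) X ++ pairs X)) ℕ.+ (missDegree S v X ℕ.+ misses S X)
      ≡⟨ cong (ℕ._+ (missDegree S v X ℕ.+ misses S X)) (≡.trans (cong length (filter-++ hit? (map (v ,_) X) (pairs X)))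
           (length-++ (filter hit? (map (v ,_) X)))) ⟩
    length (filter hit? (map (v ,_) X)) ℕ.+ length (filter hit? (pairs X)) ℕ.+ (missDegree S v X ℕ.+ misses S X)
      ≡⟨ solve 4 (λ a b c d → (a :+ b) :+ (c :+ d) := (a :+ c) :+ (b :+ d)) refl
           (length (filter hit? (map (v ,_) X))) (length (filter hit? (pairs X))) (missDegree S v X) (misses S X) ⟩
    length (filter hit? (map (v ,_) X)) ℕ.+ missDegree S v X ℕ.+ (length (filter hit? (pairs X)) ℕ.+ misses S X)
      ≡⟨ cong₂ ℕ._+_ (row X) (hits+misses S X) ⟩
    length (map (v ,_) X) ℕ.+ length (pairs X)
      ≡⟨ length-++ (map (v ,_) X) ⟨
    length (map (v ,_) X ++ pairs X) ∎
    where
    open ≡.≡-Reasoning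
    open +-*-Solver
    hit? = λ (p : V × V) → col (proj₁ p) (proj₂ p) ∈? S

    row : ∀ X → length (filter hit? (map (v ,_) X)) ℕ.+ missDegree S v X ≡ length (map (v ,_) X)
    row [] = refl
    row (x ∷ X) with col v x ∈? S
    ... | yes _ = cong suc (row X)
    ... | no _ = ≡.trans (ℕₚ.+-suc _ _) (cong suc (row X))

corollary2 : (n k : ℕ) → 1 ℕ.≤ n → 1 ℕ.≤ k →
    (e : Fin k → ℤ) →
    (∀ i j → i Fin.≤ j → e i ≥ e j) →
    sum e ≡ + (n C 2) →
    ∃[ c ] (IsGallai {n} {k} c × (∀ i → + (edgeCount c i) ≡ e i)) →
    (ℓ : ℕ) → 1 ℕ.≤ ℓ → (ℓ≤k : ℓ ℕ.≤ k) →
    sum (λ (i : Fin ℓ) → e (inject≤ i ℓ≤k)) ≥ sum (λ (i : Fin ℓ) → + n - + suc (toℕ i))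
corollary2 (suc m) k _ _ e descending _ (c , isGallai , count) ℓ _ ℓ≤k =
  -- Adding `triangle (m ∸ ℓ)` to both sides places `triangle m`, the number of all edges, between
  -- them.
  subst (sum (λ (i : Fin ℓ) → + suc m - + suc (toℕ i)) ℤ.≤_) (≡.sym (sum-inject≤ ℓ ℓ≤k (edgeCount c) count))
    (ℤ-+-cancelʳ-≤ (+ triangle (m ℕ.∸ ℓ)) (ℤₚ.≤-trans (sum-descending m ℓ) (ℤ.+≤+ covered)))
  where
  gallai : ∀ x y z → colour c x y ≢ colour c y z → colour c y z ≢ colour c x z → colour c x y ≡ colour c x z
  gallai x y z xy≢yz yz≢xz = decidable-stable (colour c x y ≟ colour c x z) λ xy≢xz →
    isGallai x y z
      (λ { refl → yz≢xz refl })
      (λ { refl → xy≢xz refl })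
      (λ { refl → xy≢yz (colour-sym c x y) })
      (xy≢yz , yz≢xz , xy≢xz)

  open Structure (colour c) (colour-sym c) gallai

  vertices = allFin (suc m)

  antitone : Antitone (edgeCount c)
  antitone {i} {j} i≤j = ℤₚ.drop‿+≤+ (subst₂ ℤ._≤_ (≡.sym (count j)) (≡.sym (count i)) (descending i j i≤j))

  covered : triangle m ℕ.≤ prefixSum ℓ (edgeCount c) ℕ.+ triangle (m ℕ.∸ ℓ)
  covered with coverable-≤ (suc m) vertices (Fin.zero , here refl) (ℕₚ.≤-reflexive (length-tabulate (λ i → i)))
  ... | coverable extra size cover
    -- Here `extra` equals m, so at most m colours may be requested. If ℓ exceeds m, then m colours
    -- already miss `triangle 0`, that is, no edges.
    with cover (ℓ ℕ.⊓ m) (m ℕ.∸ ℓ) (≡.trans (ℕₚ.m⊓n+n∸m≡n ℓ m)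
           (ℕₚ.suc-injective (≡.trans (≡.sym (length-tabulate {n = suc m} (λ i → i))) size)))
  ... | S , S≤ , few = begin
    triangle m
      ≡⟨ cong triangle (length-tabulate {n = m} Fin.suc) ⟨
    triangle (length (List.tabulate {n = m} Fin.suc))
      ≡⟨ length-pairs Fin.zero (List.tabulate {n = m} Fin.suc) ⟨
    length (pairs vertices)
      ≡⟨ hits+misses (∅ ∪ S) vertices ⟨
    hits (pairs vertices) ℕ.+ misses (∅ ∪ S) vertices
      ≡⟨ cong (λ E → hits E ℕ.+ misses (∅ ∪ S) vertices) (edges≡pairs (suc m)) ⟨
    hits (edges (suc m)) ℕ.+ misses (∅ ∪ S) vertices
      ≤⟨ ℕₚ.+-mono-≤ (ℕₚ.≤-trans (length-filter-∈ edgeColour (∅ ∪ S) (edges (suc m)))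
           (sumOver≤prefixSum (∅ ∪ S) antitone ∣∅∪S∣≤ℓ)) few ⟩
    prefixSum ℓ (edgeCount c) ℕ.+ triangle (m ℕ.∸ ℓ) ∎
    where
    open ℕₚ.≤-Reasoning
    edgeColour = λ (p : Fin (suc m) × Fin (suc m)) → colour c (proj₁ p) (proj₂ p)
    hits = λ E → length (filter (λ p → edgeColour p ∈? (∅ ∪ S)) E)

    ∣∅∪S∣≤ℓ : ∣ ∅ ∪ S ∣ ℕ.≤ ℓ
    ∣∅∪S∣≤ℓ = ℕₚ.≤-trans (ℕₚ.≤-reflexive (cong ∣_∣ (∪-identityˡ S))) (ℕₚ.≤-trans S≤ (ℕₚ.m⊓n≤m ℓ m))
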